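{- For every integer $p\geq 0$ and every integer $t\geq 0$, there is a graph $G$ of treewidth at most $t$ with \[\chi_p(G)\geq \binom{p+t}{t}.\]
   Context: All graphs are finite and simple. For an integer $p\geq 0$, a vertex coloring $\phi$ of a graph $G$ is $p$-centered if for every connected subgraph $H$ of $G$, either $\phi$ uses more than $p$ colors on $V(H)$ or there is a color that appears on exactly one vertex of $H$. The $p$-centered chromatic number $\chi_p(G)$ is the minimum number of colors in a $p$-centered coloring of $G$. Treewidth is the usual notion (minimum over tree-decompositions of the maximum bag size minus one). -}

module Defs where

open import Level using (0ℓ)
open import Data.Nat using (ℕ; zero; suc; _≤_; _<_; _+_)
open import Data.Fin using (Fin)
open import Data.Fin.Properties using (any?) renaming (_≟_ to _≟ᶠ_)
open import Data.Fin.Subset using (Subset; _∈_; ∣_∣)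
open import Data.Fin.Subset.Properties using (_∈?_)
open import Data.Vec using (tabulate)
open import Data.Product using (Σ; ∃; _×_; _,_)
open import Data.Sum using (_⊎_)
open import Data.List using (List; []; _∷_; length)
open import Data.List.Relation.Unary.Unique.Propositional using (Unique)
open import Relation.Nullary using (¬_; Dec; does)
open import Relation.Nullary.Decidable using (_×-dec_)
open import Relation.Binary.PropositionalEquality using (_≡_)

record Graph : Set₁ where
  field
    n      : ℕ
    Adj    : Fin n → Fin n → Set
    sym    : ∀ {u v} → Adj u v → Adj v u
    irrefl : ∀ {u} → ¬ Adj u u
open Graph public

data Walk {m : ℕ} (E : Fin m → Fin m → Set) : Fin m → Fin m → Set where
  here : ∀ {u} → Walk E u u
  step : ∀ {u w v} → (E u w ⊎ E w u) → Walk E w v → Walk E u v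

record Subgraph (G : Graph) : Set₁ where
  field
    S      : Subset (n G)
    F      : Fin (n G) → Fin (n G) → Set
    F-ok   : ∀ {u v} → F u v → (u ∈ S) × (v ∈ S) × Adj G u v
open Subgraph public

IsConnectedSub : (G : Graph) → Subgraph G → Set
IsConnectedSub G H =
  (∃ λ v → v ∈ S H) × (∀ u v → u ∈ S H → v ∈ S H → Walk (F H) u v)

colorsOn : {m k : ℕ} → (Fin m → Fin k) → Subset m → Subset k
colorsOn φ S = tabulate λ c → does (any? λ v → (v ∈? S) ×-dec (φ v ≟ᶠ c))

HasUniqueColor : {m k : ℕ} → (Fin m → Fin k) → Subset m → Set
HasUniqueColor φ S =
  ∃ λ v → v ∈ S × (∀ w → w ∈ S → φ w ≡ φ v → w ≡ v)

IsCentered : (p : ℕ) (G : Graph) {k : ℕ} → (Fin (n G) → Fin k) → Set₁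
IsCentered p G φ =
  (H : Subgraph G) → IsConnectedSub G H →
  (p < ∣ colorsOn φ (S H) ∣) ⊎ HasUniqueColor φ (S H)

-- m ≤ χ_p(G): every p-centered colouring uses at least m colours
-- (χ_p is the least k with a p-centered colouring into Fin k).
χ-atLeast : (p : ℕ) → Graph → ℕ → Set₁
χ-atLeast p G m = ∀ k (φ : Fin (n G) → Fin k) → IsCentered p G φ → m ≤ k

IsConnected : Graph → Set
IsConnected G = Fin (n G) × (∀ u v → Walk (Adj G) u v)

data Path {m : ℕ} (E : Fin m → Fin m → Set) : Fin m → List (Fin m) → Fin m → Set where
  single : ∀ {u} → Path E u (u ∷ []) u
  cons   : ∀ {u w vs v} → E u w → Path E w vs v → Path E u (u ∷ vs) v

HasCycle : Graph → Set
HasCycle G = ∃ λ u → ∃ λ vs → ∃ λ v →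
  Path (Adj G) u vs v × Unique vs × 3 ≤ length vs × Adj G v u

IsTree : Graph → Set
IsTree T = IsConnected T × ¬ HasCycle T

record TreeDecomposition (G : Graph) (t : ℕ) : Set₁ where
  field
    T          : Graph
    tree       : IsTree T
    bag        : Fin (n T) → Subset (n G)
    covers-v   : ∀ v → ∃ λ x → v ∈ bag x
    covers-e   : ∀ u v → Adj G u v → ∃ λ x → u ∈ bag x × v ∈ bag x
    subtree    : ∀ v x y → v ∈ bag x → v ∈ bag y →
                 Walk (λ a b → Adj T a b × v ∈ bag a × v ∈ bag b) x y
    width      : ∀ x → ∣ bag x ∣ ≤ suc t

TreewidthAtMost : Graph → ℕ → Set₁
TreewidthAtMost G t = TreeDecomposition G t

{-# OPTIONS --safe #-}
-- On a linear graph with vertices 0, …, d, let every a < b be joined by an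
-- increasing path with at most p edges. Unfold it into a tree with large
-- branching, so that every branch carries a copy. In any k-colouring the
-- pigeonhole principle yields, below each node, two equally coloured branches;
-- doubling a path along them shows that in a p-centered colouring the two ends
-- of the path have different colours, so some branch is rainbow and k ≥ d + 1.
-- The linear graph L(p,t) is L(p-1,t) followed by L(p,t-1), the last vertex of
-- the former being joined to all of the latter: Pascal's rule gives its order
-- C(p+t,t), and the bags "vertex and its earlier neighbours" have size ≤ t + 1.
module Submission where

open import Defs
open import Data.Nat using (ℕ; zero; suc; _+_; _*_; _∸_; _^_; _≤_; _<_; z≤n; s≤s)
open import Data.Nat.Properties
open import Data.Nat.Combinatorics using (_C_; nCn≡1; nCk+nC[k+1]≡[n+1]C[k+1])
open import Data.Fin using (Fin; zero; suc; toℕ; fromℕ<; combine; remQuot; funToFin; finToFun) renaming (_<_ to _<ᶠ_)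
open import Data.Fin.Properties using (remQuot-combine; combine-remQuot; finToFun-funToFin; pigeonhole; injective⇒≤; toℕ<n; toℕ-fromℕ<; toℕ-injective; any?) renaming (_≟_ to _≟ᶠ_; <⇒≢ to <⇒≢ᶠ)
open import Data.Fin.Subset using (Subset; inside; outside; ⊥; ⁅_⁆; _∪_; _∈_; ∣_∣)
open import Data.Fin.Subset.Properties using (_∈?_; ∉⊥; ∣⊥∣≡0; x∈⁅x⁆; x∈⁅y⁆⇒x≡y; x∈p∪q⁺; x∈p∪q⁻; p⊆q⇒∣p∣≤∣q∣; ∪-identityˡ)
open import Data.Vec using ([]; _∷_)
open import Data.Vec.Properties using ([]=⇒lookup; lookup∘tabulate)
open import Data.List using (List; []; _∷_; length; map; drop; _++_)
open import Data.List.Properties using (length-drop; drop-drop; length-map; ∷-injectiveˡ; ∷-injectiveʳ)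
open import Data.List.Membership.Propositional using () renaming (_∈_ to _∈ˡ_)
open import Data.List.Membership.Propositional.Properties using (∈-map⁺; ∈-map⁻; ∈-++⁺ˡ; ∈-++⁺ʳ; ∈-++⁻)
open import Data.List.Relation.Unary.Any using (here; there)
open import Data.List.Relation.Unary.All using (lookup)
open import Data.List.Relation.Unary.AllPairs using (_∷_)
open import Data.List.Relation.Unary.Unique.Propositional using (Unique)
open import Data.Product using (Σ; ∃; _×_; _,_; proj₁; proj₂)
open import Data.Sum using (_⊎_; inj₁; inj₂; swap; [_,_]′)
open import Function using (_∘_; id)
open import Relation.Nullary using (¬_; does; yes; no; contradiction)
open import Relation.Nullary.Decidable using (_×-dec_)
open import Relation.Binary.Definitions using (Symmetric; tri<; tri≈; tri>)
open import Relation.Binary.PropositionalEquality using (_≡_; _≢_; refl; trans; cong; cong₂; subst; module ≡-Reasoning) renaming (sym to ≡-sym)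

-- Finite subsets given by lists, and counting colours.

fromList : ∀ {m} → List (Fin m) → Subset m
fromList []       = ⊥
fromList (x ∷ xs) = ⁅ x ⁆ ∪ fromList xs

∈-fromList⁺ : ∀ {m} {x : Fin m} {xs} → x ∈ˡ xs → x ∈ fromList xs
∈-fromList⁺ (here refl) = x∈p∪q⁺ (inj₁ (x∈⁅x⁆ _))
∈-fromList⁺ (there x∈)  = x∈p∪q⁺ (inj₂ (∈-fromList⁺ x∈))

∈-fromList⁻ : ∀ {m} {x : Fin m} xs → x ∈ fromList xs → x ∈ˡ xs
∈-fromList⁻ []       x∈ = contradiction x∈ ∉⊥
∈-fromList⁻ (y ∷ xs) x∈ with x∈p∪q⁻ ⁅ y ⁆ (fromList xs) x∈
... | inj₁ x∈y  = here (x∈⁅y⁆⇒x≡y y x∈y)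
... | inj₂ x∈xs = there (∈-fromList⁻ xs x∈xs)

∣⁅x⁆∪p∣≤1+∣p∣ : ∀ {m} (x : Fin m) (p : Subset m) → ∣ ⁅ x ⁆ ∪ p ∣ ≤ suc ∣ p ∣
∣⁅x⁆∪p∣≤1+∣p∣ zero    (inside  ∷ p) rewrite ∪-identityˡ p = n≤1+n _
∣⁅x⁆∪p∣≤1+∣p∣ zero    (outside ∷ p) rewrite ∪-identityˡ p = ≤-refl
∣⁅x⁆∪p∣≤1+∣p∣ (suc x) (inside  ∷ p) = s≤s (∣⁅x⁆∪p∣≤1+∣p∣ x p)
∣⁅x⁆∪p∣≤1+∣p∣ (suc x) (outside ∷ p) = ∣⁅x⁆∪p∣≤1+∣p∣ x p

∣fromList∣≤length : ∀ {m} (xs : List (Fin m)) → ∣ fromList xs ∣ ≤ length xs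
∣fromList∣≤length {m} []   = ≤-reflexive (∣⊥∣≡0 m)
∣fromList∣≤length (x ∷ xs) = ≤-trans (∣⁅x⁆∪p∣≤1+∣p∣ x (fromList xs)) (s≤s (∣fromList∣≤length xs))

∈-colorsOn⁻ : ∀ {m k} (φ : Fin m → Fin k) (S : Subset m) {c} → c ∈ colorsOn φ S → ∃ λ v → v ∈ S × φ v ≡ c
∈-colorsOn⁻ φ S {c} c∈
  -- Membership of `c` says that this decision has the value `true`; abstracting it in both places
  -- makes the negative case absurd.
  with any? (λ v → (v ∈? S) ×-dec (φ v ≟ᶠ c))
     | trans (≡-sym (lookup∘tabulate (λ c → does (any? λ v → (v ∈? S) ×-dec (φ v ≟ᶠ c))) c)) ([]=⇒lookup c∈)
... | yes found | _  = found
... | no  _     | ()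

colorsOn-size : ∀ {m k} (φ : Fin m → Fin k) (S : Subset m) (cs : List (Fin k)) →
                (∀ {v} → v ∈ S → φ v ∈ˡ cs) → ∣ colorsOn φ S ∣ ≤ length cs
colorsOn-size φ S cs φS⊆cs = ≤-trans (p⊆q⇒∣p∣≤∣q∣ ⊆-cs) (∣fromList∣≤length cs)
  where
  ⊆-cs : ∀ {c} → c ∈ colorsOn φ S → c ∈ fromList cs
  ⊆-cs c∈ with ∈-colorsOn⁻ φ S c∈
  ... | v , v∈S , refl = ∈-fromList⁺ (φS⊆cs v∈S)

-- Walks, and a height criterion for acyclicity.

module _ {m} {E : Fin m → Fin m → Set} where

  _◅◅_ : ∀ {u v w} → Walk E u v → Walk E v w → Walk E u w
  here     ◅◅ q = q
  step e p ◅◅ q = step e (p ◅◅ q)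

  reverse : ∀ {u v} → Walk E u v → Walk E v u
  reverse here       = here
  reverse (step e p) = reverse p ◅◅ step (swap e) here

-- A highest vertex of a cycle would have two distinct lower neighbours.
module Acyclic {m} {E : Fin m → Fin m → Set} (h : Fin m → ℕ)
  (E-sym        : Symmetric E)
  (E-height     : ∀ {u v} → E u v → h u < h v ⊎ h v < h u)
  (lower-unique : ∀ {u v w} → E u w → E v w → h u < h w → h v < h w → u ≡ v)
  where

  EndsUpward : List (Fin m) → Fin m → Set
  EndsUpward vs v = ∃ λ q → q ∈ˡ vs × E q v × h q < h v

  -- By `lower-unique`, a path without repetitions cannot fall after it has risen: the turning point
  -- would have two lower neighbours. What remains is to fall first and perhaps rise later; the
  -- constructors keep only what the ends reveal of this.
  data Shape (u : Fin m) (vs : List (Fin m)) (v : Fin m) : Set where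
    trivial   : vs ≡ u ∷ [] → u ≡ v → Shape u vs v
    descends  : ∀ {x} → x ∈ˡ vs → E u x → h x < h u → h v < h u ⊎ EndsUpward vs v → Shape u vs v
    ascends   : h u < h v → EndsUpward vs v → Shape u vs v

  ∉-head : ∀ {u : Fin m} {vs} → Unique (u ∷ vs) → ¬ (u ∈ˡ vs)
  ∉-head (u≢ ∷ _) u∈ = lookup u≢ u∈ refl

  Unique-tail : ∀ {u : Fin m} {vs} → Unique (u ∷ vs) → Unique vs
  Unique-tail (_ ∷ us) = us

  start∈ : ∀ {u vs v} → Path E u vs v → u ∈ˡ vs
  start∈ single     = here refl
  start∈ (cons _ _) = here refl

  end∈ : ∀ {u vs v} → Path E u vs v → v ∈ˡ vs
  end∈ single     = here refl
  end∈ (cons _ p) = there (end∈ p)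

  weaken : ∀ {u vs v} → EndsUpward vs v → EndsUpward (u ∷ vs) v
  weaken (q , q∈ , rest) = q , there q∈ , rest

  shape : ∀ {u vs v} → Path E u vs v → Unique vs → Shape u vs v
  shape single     _ = trivial refl refl
  shape (cons e p) us with E-height e | shape p (Unique-tail us)
  ... | inj₁ u<w | trivial refl refl      = ascends u<w (_ , here refl , e , u<w)
  ... | inj₁ u<w | descends x∈ wx x<w _   =
          contradiction (subst (_∈ˡ _) (lower-unique (E-sym wx) e x<w u<w) x∈) (∉-head us)
  ... | inj₁ u<w | ascends w<v q          = ascends (<-trans u<w w<v) (weaken q)
  ... | inj₂ w<u | trivial refl refl      = descends (there (here refl)) e w<u (inj₁ w<u)
  ... | inj₂ w<u | descends _ _ _ (inj₁ v<w) = descends (there (start∈ p)) e w<u (inj₁ (<-trans v<w w<u))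
  ... | inj₂ w<u | descends _ _ _ (inj₂ q)   = descends (there (start∈ p)) e w<u (inj₂ (weaken q))
  ... | inj₂ w<u | ascends _ q            = descends (there (start∈ p)) e w<u (inj₂ (weaken q))

  -- Both `q` and, across the closing edge, `u` are lower neighbours of `v`, so they coincide and
  -- `u` recurs on the path.
  ¬-upward-return : ∀ {u vs v} → Unique (u ∷ vs) → E v u → h u < h v → ¬ EndsUpward vs v
  ¬-upward-return us vu u<v (q , q∈ , qv , q<v) =
    ∉-head us (subst (_∈ˡ _) (lower-unique qv (E-sym vu) q<v u<v) q∈)

  ¬-returns-to-second : ∀ {w vs v} → Path E w vs v → Unique vs → 2 ≤ length vs → v ≢ w
  ¬-returns-to-second single     _  (s≤s ()) _
  ¬-returns-to-second (cons _ p) us _        refl = ∉-head us (end∈ p)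

  acyclic : ∀ {u vs v} → Path E u vs v → Unique vs → 3 ≤ length vs → ¬ E v u
  acyclic single     _  (s≤s ())  _
  -- The first and the closing edge locate the peak of the cycle: the second vertex, the end `v`, or
  -- the start `u`. In the last case `v` would be the second vertex again.
  acyclic (cons e p) us (s≤s 2≤l) vu
    with E-height e | E-height vu | shape p (Unique-tail us)
  ... | _        | _        | trivial refl _      = contradiction 2≤l λ { (s≤s ()) }
  ... | inj₁ u<w | _        | descends x∈ wx x<w _ =
          ∉-head us (subst (_∈ˡ _) (lower-unique (E-sym wx) e x<w u<w) x∈)
  ... | inj₁ u<w | _        | ascends w<v q       = ¬-upward-return us vu (<-trans u<w w<v) q
  ... | inj₂ w<u | inj₁ v<u | _                   =
          ¬-returns-to-second p (Unique-tail us) 2≤l (lower-unique vu (E-sym e) v<u w<u)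
  ... | inj₂ w<u | inj₂ u<v | descends _ _ _ (inj₁ v<w) = <-asym u<v (<-trans v<w w<u)
  ... | inj₂ w<u | inj₂ u<v | descends _ _ _ (inj₂ q)   = ¬-upward-return us vu u<v q
  ... | inj₂ w<u | inj₂ u<v | ascends _ q               = ¬-upward-return us vu u<v q

-- Linear graphs with short increasing paths.

data Reach (R : ℕ → ℕ → Set) : ℕ → ℕ → ℕ → Set where
  here : ∀ {q a} → Reach R q a a
  snoc : ∀ {q a c b} → Reach R q a c → R c b → Reach R (suc q) a b

mapReach : ∀ {R R′ : ℕ → ℕ → Set} → (∀ {a b} → R a b → R′ a b) → ∀ {q a b} → Reach R q a b → Reach R′ q a b
mapReach f here       = here
mapReach f (snoc r e) = snoc (mapReach f r) (f e)

weakenReach : ∀ {R q a b} → Reach R q a b → Reach R (suc q) a b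
weakenReach here       = here
weakenReach (snoc r e) = snoc (weakenReach r) e

-- One less than the order of L(p,t), so that a copy started at `i` occupies the indices from `i` to
-- `i + span p t`.
span : ℕ → ℕ → ℕ
span zero    t       = 0
span (suc p) zero    = 0
span (suc p) (suc t) = span p (suc t) + suc (span (suc p) t)

span≡C : ∀ p t → suc (span p t) ≡ (p + t) C t
span≡C zero    t       = ≡-sym (nCn≡1 t)
span≡C (suc p) zero    = refl
span≡C (suc p) (suc t) = begin
  suc (span p (suc t) + suc (span (suc p) t)) ≡⟨ cong₂ _+_ (span≡C p (suc t)) (span≡C (suc p) t) ⟩
  (p + suc t) C suc t + (suc p + t) C t       ≡⟨ cong (λ s → s C suc t + (suc p + t) C t) (+-suc p t) ⟩
  (suc p + t) C suc t + (suc p + t) C t       ≡⟨ +-comm ((suc p + t) C suc t) _ ⟩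
  (suc p + t) C t + (suc p + t) C suc t       ≡⟨ nCk+nC[k+1]≡[n+1]C[k+1] (suc p + t) t ⟩
  suc (suc p + t) C suc t                     ≡⟨ cong (_C suc t) (≡-sym (+-suc (suc p) t)) ⟩
  (suc p + suc t) C suc t                     ∎
  where open ≡-Reasoning

-- The earlier neighbours of index j in the linear graph L(p,t) started at
-- index i, when the vertices K are joined to all of it. L(p+1,t+1) is
-- L(p,t+1) followed by L(p+1,t), the latter joined to the last vertex of the former.
back : ℕ → ℕ → ℕ → List ℕ → ℕ → List ℕ
back zero    t       i K j = K
back (suc p) zero    i K j = K
back (suc p) (suc t) i K j with j ≤? i + span p (suc t)
... | yes _ = back p (suc t) i K j
... | no  _ = back (suc p) t (suc (i + span p (suc t))) (i + span p (suc t) ∷ K) j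

back-⊇ : ∀ p t i K j {a} → a ∈ˡ K → a ∈ˡ back p t i K j
back-⊇ zero    t       i K j a∈ = a∈
back-⊇ (suc p) zero    i K j a∈ = a∈
back-⊇ (suc p) (suc t) i K j a∈ with j ≤? i + span p (suc t)
... | yes _ = back-⊇ p (suc t) i K j a∈
... | no  _ = back-⊇ (suc p) t _ _ j (there a∈)

-- The first index stays in the left part at every level of the recursion, so nothing is ever added
-- to `K`.
back-start : ∀ p t i K → back p t i K i ≡ K
back-start zero    t       i K = refl
back-start (suc p) zero    i K = refl
back-start (suc p) (suc t) i K with i ≤? i + span p (suc t)
... | yes _ = back-start p (suc t) i K
... | no i≰ = contradiction (m≤m+n i _) i≰

-- Entering the right part adds one vertex to `K` and lowers `t` by one; entering the left part
-- changes neither.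
back-length : ∀ p t i K j → length (back p t i K j) ≤ length K + t
back-length zero    t       i K j = m≤m+n _ t
back-length (suc p) zero    i K j = m≤m+n _ 0
back-length (suc p) (suc t) i K j with j ≤? i + span p (suc t)
... | yes _ = back-length p (suc t) i K j
... | no  _ = ≤-trans (back-length (suc p) t _ _ j) (≤-reflexive (≡-sym (+-suc (length K) t)))

back-< : ∀ p t i K j → (∀ {a} → a ∈ˡ K → a < i) → i ≤ j → ∀ {a} → a ∈ˡ back p t i K j → a < j
back-< zero    t       i K j K<i i≤j a∈ = <-≤-trans (K<i a∈) i≤j
back-< (suc p) zero    i K j K<i i≤j a∈ = <-≤-trans (K<i a∈) i≤j
back-< (suc p) (suc t) i K j K<i i≤j a∈ with j ≤? i + span p (suc t)
... | yes _   = back-< p (suc t) i K j K<i i≤j a∈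
... | no j≰   = back-< (suc p) t _ _ j
      (λ { (here refl) → ≤-refl ; (there a∈K) → <-trans (K<i a∈K) (s≤s (m≤m+n i _)) }) (≰⇒> j≰) a∈

-- This is what makes the bags a tree-decomposition: a vertex that drops out of the bags along a
-- branch never returns. The two parts interact only at the seam.
back-step : ∀ p t i K j → i ≤ j → ∀ {a} → a ∈ˡ back p t i K (suc j) → a ≡ j ⊎ a ∈ˡ back p t i K j
back-step zero    t       i K j i≤j a∈ = inj₂ a∈
back-step (suc p) zero    i K j i≤j a∈ = inj₂ a∈
back-step (suc p) (suc t) i K j i≤j a∈ with suc j ≤? i + span p (suc t) | j ≤? i + span p (suc t)
... | yes _  | yes _  = back-step p (suc t) i K j i≤j a∈
... | yes j< | no j≰  = contradiction (<⇒≤ j<) j≰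
... | no  _  | no j≰  = back-step (suc p) t _ _ j (≰⇒> j≰) a∈
-- The seam: `j` is the last vertex of the left part and `suc j` the first of the right part, whose
-- earlier neighbours are `j` and `K`.
... | no j≮  | yes j≤ with refl ← ≤-antisym j≤ (≤-pred (≰⇒> j≮))
                      with subst (_ ∈ˡ_) (back-start (suc p) t _ _) a∈
... | here a≡j  = inj₁ a≡j
... | there a∈K = inj₂ (back-⊇ p (suc t) i K j a∈K)

-- The bounds on `a` and `b` keep only the edges within the block itself, so that paths in the two
-- parts remain paths in the whole.
Link : ℕ → ℕ → ℕ → List ℕ → ℕ → ℕ → Set
Link p t i K a b = i ≤ a × a < b × b ≤ i + span p t × a ∈ˡ back p t i K b

Link-left : ∀ p t i K {a b} → Link p (suc t) i K a b → Link (suc p) (suc t) i K a b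
Link-left p t i K {a} {b} (i≤a , a<b , b≤ , a∈) =
  i≤a , a<b , ≤-trans b≤ (+-monoʳ-≤ i (m≤m+n _ _)) , a∈′
  where
  a∈′ : a ∈ˡ back (suc p) (suc t) i K b
  a∈′ with b ≤? i + span p (suc t)
  ... | yes _ = a∈
  ... | no b≰ = contradiction b≤ b≰

back-right : ∀ p t i K {b} → i + span p (suc t) < b →
  back (suc p) (suc t) i K b ≡ back (suc p) t (suc (i + span p (suc t))) (i + span p (suc t) ∷ K) b
back-right p t i K {b} m<b with b ≤? i + span p (suc t)
... | yes b≤ = contradiction b≤ (<⇒≱ m<b)
... | no  _  = refl

right-end : ∀ i m s → i + (m + suc s) ≡ suc (i + m) + s
right-end i m s = trans (≡-sym (+-assoc i m (suc s))) (+-suc (i + m) s)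

Link-right : ∀ p t i K {a b} → Link (suc p) t (suc (i + span p (suc t))) (i + span p (suc t) ∷ K) a b →
             Link (suc p) (suc t) i K a b
Link-right p t i K (m<a , a<b , b≤ , a∈) =
  ≤-trans (m≤m+n i _) (<⇒≤ m<a) , a<b , ≤-trans b≤ (≤-reflexive (≡-sym (right-end i (span p (suc t)) _))) ,
  subst (_ ∈ˡ_) (≡-sym (back-right p t i K (<-trans m<a a<b))) a∈

reach-single : ∀ {R q i a b} → i ≤ a → a ≤ b → b ≤ i + 0 → Reach R q a b
reach-single {i = i} i≤a a≤b b≤i
  with refl ← ≤-antisym a≤b (≤-trans (≤-trans b≤i (≤-reflexive (+-identityʳ i))) i≤a) = here

-- In L(p+1,t+1) the left part needs at most p edges, which leaves one for crossing: a path first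
-- goes to the last vertex of the left part, which is joined to the whole right part.
reach : ∀ p t i K {a b} → i ≤ a → a ≤ b → b ≤ i + span p t → Reach (Link p t i K) p a b
reach zero    t    i K i≤a a≤b b≤ = reach-single i≤a a≤b b≤
reach (suc p) zero i K i≤a a≤b b≤ = reach-single i≤a a≤b b≤
reach (suc p) (suc t) i K {a} {b} i≤a a≤b b≤ with b ≤? i + span p (suc t) | a ≤? i + span p (suc t)
... | yes b≤m | _       = weakenReach (mapReach (Link-left p t i K) (reach p (suc t) i K i≤a a≤b b≤m))
... | no b≰m  | no a≰m  = mapReach (Link-right p t i K)
                            (reach (suc p) t _ _ (≰⇒> a≰m) a≤b (≤-trans b≤ (≤-reflexive (right-end i _ _))))
... | no b≰m  | yes a≤m = snoc (mapReach (Link-left p t i K) (reach p (suc t) i K i≤a a≤m ≤-refl))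
    ( m≤m+n i _ , ≰⇒> b≰m , b≤
    , subst (_ ∈ˡ_) (≡-sym (back-right p t i K (≰⇒> b≰m))) (back-⊇ (suc p) t _ _ b (here refl)))

-- Vertices of a path and walks along it.

-- The end is included and the start left out, since two copies of the path will share the start. A
-- path with at most `q` edges thus lists at most `q` vertices.
mids : ∀ {R q a b} → Reach R q a b → List ℕ
mids here               = []
mids (snoc {b = b} r _) = b ∷ mids r

length-mids : ∀ {R q a b} (r : Reach R q a b) → length (mids r) ≤ q
length-mids here       = z≤n
length-mids (snoc r _) = s≤s (length-mids r)

start-or-mid : ∀ {R q a b} (r : Reach R q a b) → a ≡ b ⊎ b ∈ˡ mids r
start-or-mid here       = inj₁ refl
start-or-mid (snoc _ _) = inj₂ (here refl)

mids-above : ∀ {R q a b} → (∀ {i j} → R i j → i < j) → (r : Reach R q a b) → ∀ {c} → c ∈ˡ mids r → a < c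
mids-above R⇒< (snoc r e) (there c∈)  = mids-above R⇒< r c∈
mids-above R⇒< (snoc r e) (here refl) with start-or-mid r
... | inj₁ refl = R⇒< e
... | inj₂ c∈   = <-trans (mids-above R⇒< r c∈) (R⇒< e)

mids-satisfy : ∀ {R q a b} {P : ℕ → Set} → (∀ {i j} → R i j → P j) → (r : Reach R q a b) → ∀ {c} → c ∈ˡ mids r → P c
mids-satisfy R⇒P (snoc r e) (here refl) = R⇒P e
mids-satisfy R⇒P (snoc r e) (there c∈)  = mids-satisfy R⇒P r c∈

-- Edges are asked for only between vertices of the path, because the image lies in a subgraph that
-- has no others to offer.
walk-to-start : ∀ {m R q a b} {F : Fin m → Fin m → Set} (f : ℕ → Fin m) (r : Reach R q a b) →
  (∀ {i j} → i ∈ˡ (a ∷ mids r) → j ∈ˡ (a ∷ mids r) → R i j → F (f i) (f j)) →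
  ∀ {c} → c ∈ˡ (a ∷ mids r) → Walk F (f c) (f a)
walk-to-start                     f r                  f-edge (here refl) = here
walk-to-start {R = R} {a = a} {F = F} f (snoc {c = e} {b = b} r eb) f-edge (there c∈) = go c∈
  where
  keep : ∀ {i} → i ∈ˡ (a ∷ mids r) → i ∈ˡ (a ∷ b ∷ mids r)
  keep (here refl) = here refl
  keep (there i∈)  = there (there i∈)

  e∈ : e ∈ˡ (a ∷ mids r)
  e∈ with start-or-mid r
  ... | inj₁ refl = here refl
  ... | inj₂ e∈r  = there e∈r

  before : ∀ {c} → c ∈ˡ (a ∷ mids r) → Walk F (f c) (f a)
  before = walk-to-start f r (λ i∈ j∈ → f-edge (keep i∈) (keep j∈))

  go : ∀ {c} → c ∈ˡ (b ∷ mids r) → Walk F (f c) (f a)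
  go (here refl) = step (inj₂ (f-edge (keep e∈) (there (here refl)) eb)) (before e∈)
  go (there c∈r) = before (there c∈r)

-- Nodes of a rooted tree, their ancestors and their numbering.

-- Nodes of a rooted tree are lists with the most recent choice first, so
-- anc x j is the ancestor of x at depth j (for j ≤ length x).
anc : ∀ {A : Set} → List A → ℕ → List A
anc x j = drop (length x ∸ j) x

module _ {A : Set} where

  length-anc : (x : List A) → ∀ {j} → j ≤ length x → length (anc x j) ≡ j
  length-anc x {j} j≤ = trans (length-drop (length x ∸ j) x) (m∸[m∸n]≡n j≤)

  anc-self : (x : List A) → anc x (length x) ≡ x
  anc-self x = cong (λ s → drop s x) (n∸n≡0 (length x))

  anc-∷ : ∀ (c : A) x {j} → j ≤ length x → anc (c ∷ x) j ≡ anc x j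
  anc-∷ c x j≤ = cong (λ s → drop s (c ∷ x)) (+-∸-assoc 1 j≤)

  anc-anc : (x : List A) → ∀ {i j} → i ≤ j → j ≤ length x → anc (anc x j) i ≡ anc x i
  anc-anc x {i} {j} i≤j j≤ = begin
    drop (length (anc x j) ∸ i) (anc x j)   ≡⟨ cong (λ l → drop (l ∸ i) (anc x j)) (length-anc x j≤) ⟩
    drop (j ∸ i) (drop (length x ∸ j) x)    ≡⟨ drop-drop (length x ∸ j) (j ∸ i) x ⟩
    drop ((length x ∸ j) + (j ∸ i)) x       ≡⟨ cong (λ s → drop s x) (≡-sym (+-∸-assoc (length x ∸ j) i≤j)) ⟩
    drop ((length x ∸ j) + j ∸ i) x         ≡⟨ cong (λ s → drop (s ∸ i) x) (m∸n+n≡m j≤) ⟩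
    drop (length x ∸ i) x                   ∎
    where open ≡-Reasoning

module Encoding (N : ℕ) where

  -- The number of lists over `Fin N` of length at most `d`: the empty list, or a letter followed by
  -- a list one shorter in bound.
  size : ℕ → ℕ
  size zero    = 1
  size (suc d) = suc (N * size d)

  decode : ∀ d → Fin (size d) → List (Fin N)
  decode zero    _       = []
  decode (suc d) zero    = []
  decode (suc d) (suc i) = proj₁ (remQuot {N} (size d) i) ∷ decode d (proj₂ (remQuot {N} (size d) i))

  -- Lists longer than d are truncated.
  encode : ∀ d → List (Fin N) → Fin (size d)
  encode zero    _       = zero
  encode (suc d) []      = zero
  encode (suc d) (c ∷ x) = suc (combine c (encode d x))

  length-decode : ∀ d i → length (decode d i) ≤ d
  length-decode zero    _       = z≤n
  length-decode (suc d) zero    = z≤n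
  length-decode (suc d) (suc i) = s≤s (length-decode d _)

  decode-encode : ∀ d x → length x ≤ d → decode d (encode d x) ≡ x
  decode-encode zero    []      _        = refl
  decode-encode (suc d) []      _        = refl
  decode-encode (suc d) (c ∷ x) (s≤s x≤) =
    trans (cong (λ q → proj₁ q ∷ decode d (proj₂ q)) (remQuot-combine {N} c (encode d x)))
          (cong (c ∷_) (decode-encode d x x≤))

  encode-decode : ∀ d i → encode d (decode d i) ≡ i
  encode-decode zero    zero    = refl
  encode-decode (suc d) zero    = refl
  encode-decode (suc d) (suc i) = cong suc (trans
    (cong (combine (proj₁ (remQuot {N} (size d) i))) (encode-decode d _)) (combine-remQuot {N} (size d) i))

-- The blown-up graph and its underlying tree.

-- The N-fold branching tree of depth d, every branch of which carries a copy
-- of the linear graph in which j has the earlier neighbours K j.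
module BlowUp (N d : ℕ) (K : ℕ → List ℕ) (K-< : ∀ j {i} → i ∈ˡ K j → i < j)
              (K-step : ∀ j {i} → i ∈ˡ K (suc j) → i ≡ j ⊎ i ∈ˡ K j) where

  open Encoding N

  V : Set
  V = Fin (size d)

  node : V → List (Fin N)
  node = decode d

  vertex : List (Fin N) → V
  vertex = encode d

  node-vertex : ∀ {x} → length x ≤ d → node (vertex x) ≡ x
  node-vertex = decode-encode d _

  -- The depth of a node serves as its index in the linear graph.
  IsBack : List (Fin N) → List (Fin N) → Set
  IsBack x y = ∃ λ i → i ∈ˡ K (length y) × x ≡ anc y i

  ¬IsBack-self : ∀ {x} → ¬ IsBack x x
  ¬IsBack-self {x} (i , i∈ , x≡) =
    <⇒≢ (K-< _ i∈) (≡-sym (trans (cong length x≡) (length-anc x (<⇒≤ (K-< _ i∈)))))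

  blowUp : Graph
  blowUp = record
    { n      = size d
    ; Adj    = λ u v → IsBack (node u) (node v) ⊎ IsBack (node v) (node u)
    ; sym    = swap
    ; irrefl = [ ¬IsBack-self , ¬IsBack-self ]′
    }

  IsChild : List (Fin N) → List (Fin N) → Set
  IsChild x y = ∃ λ c → x ≡ c ∷ y

  IsChild-< : ∀ {x y} → IsChild x y → length y < length x
  IsChild-< (c , refl) = ≤-refl

  TreeAdj : V → V → Set
  TreeAdj u v = IsChild (node u) (node v) ⊎ IsChild (node v) (node u)

  tree : Graph
  tree = record
    { n      = size d
    ; Adj    = TreeAdj
    ; sym    = swap
    ; irrefl = [ <-irrefl refl ∘ IsChild-< , <-irrefl refl ∘ IsChild-< ]′
    }

  node-injective : ∀ {u v} → node u ≡ node v → u ≡ v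
  node-injective {u} {v} eq = trans (≡-sym (encode-decode d u)) (trans (cong vertex eq) (encode-decode d v))

  parent-unique : ∀ {u v w} → TreeAdj u w → TreeAdj v w →
                  length (node u) < length (node w) → length (node v) < length (node w) → u ≡ v
  parent-unique (inj₁ uw) _         u<w _   = contradiction (IsChild-< uw) (<⇒≯ u<w)
  parent-unique _         (inj₁ vw) _   v<w = contradiction (IsChild-< vw) (<⇒≯ v<w)
  parent-unique (inj₂ (_ , w≡)) (inj₂ (_ , w≡′)) _ _ = node-injective (∷-injectiveʳ (trans (≡-sym w≡) w≡′))

  TreeAdj-height : ∀ {u v} → TreeAdj u v → length (node u) < length (node v) ⊎ length (node v) < length (node u)
  TreeAdj-height (inj₁ uv) = inj₂ (IsChild-< uv)
  TreeAdj-height (inj₂ vu) = inj₁ (IsChild-< vu)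

  parent-edge : ∀ c x → length (c ∷ x) ≤ d → TreeAdj (vertex (c ∷ x)) (vertex x)
  parent-edge c x c∷x≤ = inj₁ (c , trans (node-vertex c∷x≤) (cong (c ∷_) (≡-sym (node-vertex (<⇒≤ c∷x≤)))))

  tree-isTree : IsTree tree
  tree-isTree = (vertex [] , connected) , λ { (_ , _ , _ , p , us , 3≤ , vu) → acyclic p us 3≤ vu }
    where
    open Acyclic {E = TreeAdj} (length ∘ node) swap TreeAdj-height parent-unique
    to-root : ∀ x → length x ≤ d → Walk TreeAdj (vertex x) (vertex [])
    to-root []      _  = here
    to-root (c ∷ x) x≤ = step (inj₁ (parent-edge c x x≤)) (to-root x (<⇒≤ x≤))
    root-walk : ∀ u → Walk TreeAdj u (vertex [])
    root-walk u = subst (λ w → Walk TreeAdj w (vertex [])) (encode-decode d u) (to-root (node u) (length-decode d u))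
    connected : ∀ u v → Walk TreeAdj u v
    connected u v = root-walk u ◅◅ reverse (root-walk v)

  -- The tree-decomposition.

  bagList : List (Fin N) → List (List (Fin N))
  bagList y = map (anc y) (length y ∷ K (length y))

  bag : V → Subset (size d)
  bag u = fromList (map vertex (bagList (node u)))

  ∈-bag⁺ : ∀ {u v} → node u ∈ˡ bagList (node v) → u ∈ bag v
  ∈-bag⁺ {u} {v} u∈ = subst (_∈ bag v) (encode-decode d u) (∈-fromList⁺ (∈-map⁺ vertex u∈))

  ∈-bagList⁻ : ∀ {x} y → x ∈ˡ bagList y → x ≡ y ⊎ IsBack x y
  ∈-bagList⁻ y (here x≡)  = inj₁ (trans x≡ (anc-self y))
  ∈-bagList⁻ y (there x∈) = inj₂ (∈-map⁻ (anc y) x∈)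

  ∈-bagList⁺ : ∀ {x} y → x ≡ y ⊎ IsBack x y → x ∈ˡ bagList y
  ∈-bagList⁺ y (inj₁ refl)            = here (≡-sym (anc-self y))
  ∈-bagList⁺ y (inj₂ (i , i∈ , refl)) = there (∈-map⁺ (anc y) i∈)

  length-∈-bagList : ∀ {x} y → x ∈ˡ bagList y → length x ≤ length y
  length-∈-bagList y x∈ with ∈-bagList⁻ y x∈
  ... | inj₁ refl            = ≤-refl
  ... | inj₂ (i , i∈ , refl) = ≤-trans (≤-reflexive (length-anc y (<⇒≤ (K-< _ i∈)))) (<⇒≤ (K-< _ i∈))

  ∈-bag⁻ : ∀ {u v} → u ∈ bag v → node u ∈ˡ bagList (node v)
  ∈-bag⁻ {u} {v} u∈ with ∈-map⁻ vertex (∈-fromList⁻ (map vertex (bagList (node v))) u∈)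
  ... | x , x∈ , refl =
    subst (_∈ˡ bagList (node v)) (≡-sym (node-vertex (≤-trans (length-∈-bagList (node v) x∈) (length-decode d v)))) x∈

  -- `K-step` carried over to a branch: the earlier neighbour is at the depth of `y`, hence is `y`
  -- itself, or it is already an earlier neighbour of `y`.
  bagList-parent : ∀ c y {x} → x ∈ˡ bagList (c ∷ y) → x ≡ c ∷ y ⊎ x ∈ˡ bagList y
  bagList-parent c y x∈ with ∈-bagList⁻ (c ∷ y) x∈
  ... | inj₁ x≡ = inj₁ x≡
  ... | inj₂ (i , i∈ , refl) with anc-∷ c y (≤-pred (K-< _ i∈)) | K-step _ i∈
  ... | anc≡ | inj₁ refl = inj₂ (∈-bagList⁺ y (inj₁ (trans anc≡ (anc-self y))))
  ... | anc≡ | inj₂ i∈y  = inj₂ (∈-bagList⁺ y (inj₂ (i , i∈y , anc≡)))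

  treeDecomposition : ∀ t → (∀ j → length (K j) ≤ t) → TreeDecomposition blowUp t
  treeDecomposition t K-length = record
    { T        = tree
    ; tree     = tree-isTree
    ; bag      = bag
    ; covers-v = λ v → v , self∈bag v
    ; covers-e = λ where
        u v (inj₁ uv) → v , ∈-bag⁺ (∈-bagList⁺ _ (inj₂ uv)) , self∈bag v
        u v (inj₂ vu) → u , self∈bag u , ∈-bag⁺ (∈-bagList⁺ _ (inj₂ vu))
    ; subtree  = λ v x y v∈x v∈y → to-self v x v∈x ◅◅ reverse (to-self v y v∈y)
    ; width    = λ x → ≤-trans (∣fromList∣≤length (map vertex (bagList (node x))))
                           (≤-trans (≤-reflexive (length-bagList x)) (s≤s (K-length _)))
    }
    where
    length-bagList : ∀ x → length (map vertex (bagList (node x))) ≡ suc (length (K (length (node x))))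
    length-bagList x = trans (length-map vertex (bagList (node x)))
                             (length-map (anc (node x)) (length (node x) ∷ K (length (node x))))

    self∈bag : ∀ v → v ∈ bag v
    self∈bag v = ∈-bag⁺ (∈-bagList⁺ (node v) (inj₁ refl))

    Shared : V → V → V → Set
    Shared v a b = TreeAdj a b × v ∈ bag a × v ∈ bag b

    -- By `bagList-parent`, `v` stays in the bag on the way up to the root until the node is `v`
    -- itself. Two nodes whose bags contain `v` are then joined through `v`.
    climb : ∀ v y → length y ≤ d → v ∈ bag (vertex y) → Walk (Shared v) (vertex y) v
    climb v y y≤ v∈ with subst (λ z → node v ∈ˡ bagList z) (node-vertex y≤) (∈-bag⁻ v∈)
    climb v []      y≤ v∈ | v∈L with ∈-bagList⁻ [] v∈L
    ... | inj₁ v≡           = subst (Walk (Shared v) _) (≡-sym (node-injective (trans v≡ (≡-sym (node-vertex y≤))))) here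
    ... | inj₂ (_ , i∈ , _) = contradiction (K-< 0 i∈) λ ()
    climb v (c ∷ y) y≤ v∈ | v∈L with bagList-parent c y v∈L
    ... | inj₁ v≡ = subst (Walk (Shared v) _) (≡-sym (node-injective (trans v≡ (≡-sym (node-vertex y≤))))) here
    ... | inj₂ v∈L′ = step (inj₁ (parent-edge c y y≤ , v∈ , v∈′)) (climb v y (<⇒≤ y≤) v∈′)
      where
      v∈′ : v ∈ bag (vertex y)
      v∈′ = ∈-bag⁺ (subst (λ z → node v ∈ˡ bagList z) (≡-sym (node-vertex (<⇒≤ y≤))) v∈L′)

    to-self : ∀ v x → v ∈ bag x → Walk (Shared v) x v
    to-self v x v∈ = subst (λ w → Walk (Shared v) w v) (encode-decode d x)
      (climb v (node x) (length-decode d x) (subst (λ w → v ∈ bag w) (≡-sym (encode-decode d x)) v∈))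

  -- Copies of the linear graph along branches.

  Forward : ℕ → ℕ → Set
  Forward i j = i < j × j ≤ d × i ∈ˡ K j

  at : List (Fin N) → ℕ → V
  at y j = vertex (anc y j)

  module _ {y : List (Fin N)} (|y|≡d : length y ≡ d) where

    length-anc-leaf : ∀ {j} → j ≤ d → length (anc y j) ≡ j
    length-anc-leaf j≤d = length-anc y (≤-trans j≤d (≤-reflexive (≡-sym |y|≡d)))

    node-at : ∀ {j} → j ≤ d → node (at y j) ≡ anc y j
    node-at j≤d = node-vertex (≤-trans (≤-reflexive (length-anc-leaf j≤d)) j≤d)

    at-adjacent : ∀ {i j} → Forward i j → Adj blowUp (at y i) (at y j)
    at-adjacent {i} {j} (i<j , j≤d , i∈) = inj₁ (i ,
      subst (λ l → i ∈ˡ K l) (≡-sym (trans (cong length (node-at j≤d)) (length-anc-leaf j≤d))) i∈ ,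
      trans (node-at (≤-trans (<⇒≤ i<j) j≤d))
            (trans (≡-sym (anc-anc y (<⇒≤ i<j) (≤-trans j≤d (≤-reflexive (≡-sym |y|≡d)))))
                   (cong (λ x → anc x i) (≡-sym (node-at j≤d)))))

    at-injective : ∀ {i j} → i ≤ d → j ≤ d → at y i ≡ at y j → i ≡ j
    at-injective {i} {j} i≤d j≤d eq = begin
      i                       ≡⟨ ≡-sym (length-anc-leaf i≤d) ⟩
      length (anc y i)        ≡⟨ cong length (≡-sym (node-at i≤d)) ⟩
      length (node (at y i))  ≡⟨ cong (length ∘ node) eq ⟩
      length (node (at y j))  ≡⟨ cong length (node-at j≤d) ⟩
      length (anc y j)        ≡⟨ length-anc-leaf j≤d ⟩
      j                       ∎
      where open ≡-Reasoning

  -- Doubling a path in a centered colouring.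

  module Centered {p k} (φ : V → Fin k) (centered : IsCentered p blowUp φ) where

    -- Two equally coloured branches y, z that part right below depth a: the
    -- union of the copies in y and z of a path from a to b repeats each colour
    -- except possibly that of a, which then cannot recur at b.
    twins⇒≢ : ∀ {y z a b} → length y ≡ d → length z ≡ d → a < b → b ≤ d → anc y a ≡ anc z a →
              (∀ {j} → a < j → j ≤ d → anc y j ≢ anc z j) →
              (∀ {j} → j ≤ d → φ (at y j) ≡ φ (at z j)) →
              Reach Forward p a b → φ (at y a) ≢ φ (at y b)
    twins⇒≢ {y} {z} {a} {b} |y| |z| a<b b≤d meet part same r φa≡φb =
      [ ≤⇒≯ few-colours , ¬unique ]′ (centered H H-connected)
      where
      ms : List ℕ
      ms = mids r

      vs : List V
      -- The copies share their start: `at z a` equals `at y a` by `meet`, so it is listed once.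
      vs = at y a ∷ map (at y) ms ++ map (at z) ms

      U : Subset (size d)
      U = fromList vs

      H : Subgraph blowUp
      H = record { S = U ; F = λ u w → u ∈ U × w ∈ U × Adj blowUp u w ; F-ok = id }

      data Member : V → Set where
        top   : Member (at y a)
        left  : ∀ {c} → c ∈ˡ ms → Member (at y c)
        right : ∀ {c} → c ∈ˡ ms → Member (at z c)

      member : ∀ {u} → u ∈ U → Member u
      member u∈ with ∈-fromList⁻ vs u∈
      ... | here refl = top
      ... | there u∈′ with ∈-++⁻ (map (at y) ms) u∈′
      ... | inj₁ u∈y with _ , c∈ , refl ← ∈-map⁻ (at y) u∈y = left c∈
      ... | inj₂ u∈z with _ , c∈ , refl ← ∈-map⁻ (at z) u∈z = right c∈

      at-y∈ : ∀ {c} → c ∈ˡ (a ∷ ms) → at y c ∈ U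
      at-y∈ (here refl) = ∈-fromList⁺ {xs = vs} (here refl)
      at-y∈ (there c∈)  = ∈-fromList⁺ (there (∈-++⁺ˡ (∈-map⁺ (at y) c∈)))

      at-z∈ : ∀ {c} → c ∈ˡ (a ∷ ms) → at z c ∈ U
      at-z∈ (here refl) = ∈-fromList⁺ {xs = vs} (here (cong vertex (≡-sym meet)))
      at-z∈ (there c∈)  = ∈-fromList⁺ (there (∈-++⁺ʳ (map (at y) ms) (∈-map⁺ (at z) c∈)))

      to-top : ∀ {u} → Member u → Walk (F H) u (at y a)
      to-top top        = here
      to-top (left c∈)  = walk-to-start (at y) r (λ i∈ j∈ e → at-y∈ i∈ , at-y∈ j∈ , at-adjacent |y| e) (there c∈)
      to-top (right c∈) = subst (Walk (F H) _) (cong vertex (≡-sym meet))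
        (walk-to-start (at z) r (λ i∈ j∈ e → at-z∈ i∈ , at-z∈ j∈ , at-adjacent |z| e) (there c∈))

      H-connected : IsConnectedSub blowUp H
      H-connected = (at y a , at-y∈ (here refl)) ,
        λ u w u∈ w∈ → to-top (member u∈) ◅◅ reverse (to-top (member w∈))

      below : ∀ {c} → c ∈ˡ ms → a < c
      below = mids-above proj₁ r

      ≤d : ∀ {c} → c ∈ˡ ms → c ≤ d
      ≤d = mids-satisfy (proj₁ ∘ proj₂) r

      b∈ : b ∈ˡ ms
      b∈ with start-or-mid r
      ... | inj₁ a≡b = contradiction a≡b (<⇒≢ a<b)
      ... | inj₂ b∈  = b∈

      -- The colours of `ms` in `y` are all there are: the copy in `z` repeats them, and the colour
      -- of the start recurs at `b`. The path has at most `p` edges, so `ms` has at most `p`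
      -- entries.
      few-colours : ∣ colorsOn φ U ∣ ≤ p
      few-colours = ≤-trans (colorsOn-size φ U (map (φ ∘ at y) ms) (colour ∘ member))
                            (≤-trans (≤-reflexive (length-map _ ms)) (length-mids r))
        where
        colour : ∀ {u} → Member u → φ u ∈ˡ map (φ ∘ at y) ms
        colour top        = subst (_∈ˡ map (φ ∘ at y) ms) (≡-sym φa≡φb) (∈-map⁺ (φ ∘ at y) b∈)
        colour (left c∈)  = ∈-map⁺ (φ ∘ at y) c∈
        colour (right c∈) = subst (_∈ˡ map (φ ∘ at y) ms) (same (≤d c∈)) (∈-map⁺ (φ ∘ at y) c∈)

      at-y≢at-z : ∀ {c} → c ∈ˡ ms → at y c ≢ at z c
      at-y≢at-z c∈ eq = part (below c∈) (≤d c∈)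
        (trans (≡-sym (node-at |y| (≤d c∈))) (trans (cong node eq) (node-at |z| (≤d c∈))))

      ¬unique : ¬ HasUniqueColor φ U
      ¬unique (u , u∈ , unique) with member u∈
      ... | top      = <⇒≢ a<b (≡-sym (at-injective |y| b≤d (≤-trans (<⇒≤ a<b) b≤d)
                         (unique (at y b) (at-y∈ (there b∈)) (≡-sym φa≡φb))))
      ... | left c∈  = at-y≢at-z c∈ (≡-sym (unique _ (at-z∈ (there c∈)) (≡-sym (same (≤d c∈)))))
      ... | right c∈ = at-y≢at-z c∈ (unique _ (at-y∈ (there c∈)) (same (≤d c∈)))

    -- Rainbow branches by pigeonhole.

    module _ (reachable : ∀ {a b} → a < b → b ≤ d → Reach Forward p a b) (k^[1+d]<N : k ^ suc d < N) where

      -- The whole colour sequence of a branch, coded as one number so that `pigeonhole` can compare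
      -- it with the number `N` of children.
      colours : List (Fin N) → Fin (k ^ suc d)
      colours y = funToFin {suc d} (λ j → φ (at y (toℕ j)))

      RainbowBelow : List (Fin N) → Set
      RainbowBelow x = ∃ λ y → length y ≡ d × anc y (length x) ≡ x ×
        (∀ {a b} → length x ≤ a → a < b → b ≤ d → φ (at y a) ≢ φ (at y b))

      -- Induction on the number `r` of levels below `x`. Each child of `x` has a branch that is
      -- rainbow from the child on, and two of these branches have the same colours. They part right
      -- below `x`, so `twins⇒≢` separates the colour of `x` from all later ones.
      rainbowBelow : ∀ r x → length x + r ≡ d → RainbowBelow x
      rainbowBelow zero x |x|+0≡d = x , |x|≡d , anc-self x ,
          λ x≤a a<b b≤d → contradiction b≤d (<⇒≱ (≤-<-trans (≤-trans (≤-reflexive (≡-sym |x|≡d)) x≤a) a<b))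
        where
        |x|≡d : length x ≡ d
        |x|≡d = trans (≡-sym (+-identityʳ _)) |x|+0≡d
      rainbowBelow (suc r) x |x|+r≡d
        = y , |y| , through y |y| y-anc , rainbow
        where
        below : ∀ c → RainbowBelow (c ∷ x)
        below c = rainbowBelow r (c ∷ x) (trans (≡-sym (+-suc (length x) r)) |x|+r≡d)

        twins : ∃ λ c₁ → ∃ λ c₂ → c₁ <ᶠ c₂ × colours (proj₁ (below c₁)) ≡ colours (proj₁ (below c₂))
        twins = pigeonhole k^[1+d]<N (colours ∘ proj₁ ∘ below)

        c₁ c₂ : Fin N
        c₁ = proj₁ twins
        c₂ = proj₁ (proj₂ twins)

        y z : List (Fin N)
        y = proj₁ (below c₁)
        z = proj₁ (below c₂)

        |y| : length y ≡ d
        |y| = proj₁ (proj₂ (below c₁))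

        |z| : length z ≡ d
        |z| = proj₁ (proj₂ (below c₂))

        y-anc : anc y (suc (length x)) ≡ c₁ ∷ x
        y-anc = proj₁ (proj₂ (proj₂ (below c₁)))

        z-anc : anc z (suc (length x)) ≡ c₂ ∷ x
        z-anc = proj₁ (proj₂ (proj₂ (below c₂)))

        x<d : length x < d
        x<d = ≤-trans (m≤m+n _ r) (≤-reflexive (trans (≡-sym (+-suc (length x) r)) |x|+r≡d))

        through : ∀ w → length w ≡ d → ∀ {c} → anc w (suc (length x)) ≡ c ∷ x → anc w (length x) ≡ x
        through w |w| {c} w-anc = begin
          anc w (length x)                          ≡⟨ ≡-sym (anc-anc w (n≤1+n _) (≤-trans x<d (≤-reflexive (≡-sym |w|)))) ⟩
          anc (anc w (suc (length x))) (length x)   ≡⟨ cong (λ u → anc u (length x)) w-anc ⟩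
          anc (c ∷ x) (length x)                    ≡⟨ anc-∷ c x ≤-refl ⟩
          anc x (length x)                          ≡⟨ anc-self x ⟩
          x                                         ∎
          where open ≡-Reasoning

        -- Agreement at any depth below `x` would pass up to the children `c₁` and `c₂`, which
        -- differ.
        part : ∀ {j} → length x < j → j ≤ d → anc y j ≢ anc z j
        part {j} x<j j≤d y≡z = <⇒≢ᶠ (proj₁ (proj₂ (proj₂ twins))) (∷-injectiveˡ (begin
          c₁ ∷ x                         ≡⟨ ≡-sym y-anc ⟩
          anc y (suc (length x))         ≡⟨ ≡-sym (anc-anc y x<j (≤-trans j≤d (≤-reflexive (≡-sym |y|)))) ⟩
          anc (anc y j) (suc (length x)) ≡⟨ cong (λ u → anc u (suc (length x))) y≡z ⟩
          anc (anc z j) (suc (length x)) ≡⟨ anc-anc z x<j (≤-trans j≤d (≤-reflexive (≡-sym |z|))) ⟩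
          anc z (suc (length x))         ≡⟨ z-anc ⟩
          c₂ ∷ x                         ∎))
          where open ≡-Reasoning

        -- Equal codes have equal entries; the entry at position `j` is decoded from both.
        same : ∀ {j} → j ≤ d → φ (at y j) ≡ φ (at z j)
        same {j} j≤d = subst (λ i → φ (at y i) ≡ φ (at z i)) (toℕ-fromℕ< (s≤s j≤d))
          (trans (≡-sym (finToFun-funToFin {suc d} (λ i → φ (at y (toℕ i))) j′))
            (trans (cong (λ f → finToFun {k} {suc d} f j′) (proj₂ (proj₂ (proj₂ twins))))
              (finToFun-funToFin {suc d} (λ i → φ (at z (toℕ i))) j′)))
          where
          j′ : Fin (suc d)
          j′ = fromℕ< (s≤s j≤d)

        rainbow : ∀ {a b} → length x ≤ a → a < b → b ≤ d → φ (at y a) ≢ φ (at y b)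
        rainbow x≤a a<b b≤d with m≤n⇒m<n∨m≡n x≤a
        ... | inj₁ x<a  = proj₂ (proj₂ (proj₂ (below c₁))) x<a a<b b≤d
        ... | inj₂ refl = twins⇒≢ |y| |z| a<b b≤d (trans (through y |y| y-anc) (≡-sym (through z |z| z-anc)))
                            part same (reachable a<b b≤d)

      -- A branch that is rainbow from the root on shows different colours at all `suc d` depths.
      1+d≤k : suc d ≤ k
      1+d≤k with rainbowBelow d [] refl
      ... | y , _ , _ , rainbow = injective⇒≤ {f = λ i → φ (at y (toℕ i))} injective
        where
        injective : ∀ {i j : Fin (suc d)} → φ (at y (toℕ i)) ≡ φ (at y (toℕ j)) → i ≡ j
        injective {i} {j} eq with <-cmp (toℕ i) (toℕ j)
        ... | tri< i<j _ _ = contradiction eq (rainbow z≤n i<j (≤-pred (toℕ<n j)))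
        ... | tri≈ _ i≡j _ = toℕ-injective i≡j
        ... | tri> _ _ j<i = contradiction (≡-sym eq) (rainbow z≤n j<i (≤-pred (toℕ<n i)))

-- Choice of the branching number and the resulting bound.

theorem5 : (p t : ℕ) → Σ Graph λ G → TreewidthAtMost G t × χ-atLeast p G ((p + t) C t)
theorem5 p t = blowUp , treeDecomposition t (back-length p t 0 []) , lower-bound
  where
  d : ℕ
  d = span p t

  K-< : ∀ j {i} → i ∈ˡ back p t 0 [] j → i < j
  K-< j = back-< p t 0 [] j (λ ()) z≤n

  K-step : ∀ j {i} → i ∈ˡ back p t 0 [] (suc j) → i ≡ j ⊎ i ∈ˡ back p t 0 [] j
  K-step j = back-step p t 0 [] j z≤n

  -- The graph is fixed before `k` is known, so the branching number must exceed `k ^ suc d` for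
  -- every `k` that could violate the bound, that is for all `k` up to `d`.
  open BlowUp (suc (suc d ^ suc d)) d (back p t 0 []) K-< K-step

  lower-bound : χ-atLeast p blowUp ((p + t) C t)
  lower-bound k φ centered with suc d ≤? k
  ... | yes d<k = subst (_≤ k) (span≡C p t) d<k
  ... | no  d≮k = subst (_≤ k) (span≡C p t) (1+d≤k
        -- For a linear graph started at 0, dropping `0 ≤ a` from `Link` leaves `Forward`.
        (λ a<b b≤d → mapReach proj₂ (reach p t 0 [] z≤n (<⇒≤ a<b) b≤d))
        (s≤s (^-monoˡ-≤ (suc d) (<⇒≤ (≰⇒> d≮k)))))
    where open Centered {p} φ centered
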